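{- Suppose that there are two targets $t_1,t_2$. Any deterministic (possibly adaptive) algorithm needs in the worst case at least $\frac{n}{2}-1$ two-direction queries to detect one of the two targets, even when the graph is an unweighted cycle with $n$ vertices.
   Context: Graphs $G=(V,E)$, $|V|=n$, are connected, simple, undirected, with positive edge weights $w$ (unweighted: all weights $1$); $d$ is the shortest-path distance, and $N(v)$ is the set of neighbors of $v$. For $u\in N(v)$, $N(v,u)=\{x\in V: d(v,x)=w(vu)+d(u,x)\}$. The unknown (distinct) targets $t_1,t_2\in V$ are placed by an adversary. A two-direction query at vertex $v$ returns an unordered pair of (not necessarily distinct) vertices $\{u,u'\}\subseteq N(v)$ such that $t_1\in N(v,u)$ and $t_2\in N(v,u')$; since the pair is unordered, the response does not clarify which target belongs to $N(v,u)$ and which to $N(v,u')$. If $v$ is itself a target, the query reveals this. To detect a target means to determine with certainty some vertex that is a target. -}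

module Defs where

open import Data.Nat using (ℕ; zero; suc; _+_; _≤_; _<_; z≤n; s≤s)
open import Data.Nat.Properties using (≤-trans; <-trans; n<1+n; 1+n≢n)
open import Data.Fin using (Fin; toℕ; fromℕ<)
open import Data.Fin.Properties using (toℕ-fromℕ<; fromℕ<-toℕ; toℕ<n)
open import Data.Fin.Subset using (Subset; ⁅_⁆; _∪_)
open import Data.Product using (∃-syntax; _×_; _,_)
open import Data.Sum using (_⊎_; inj₁; inj₂; swap)
open import Relation.Nullary using (¬_; contradiction)
open import Relation.Binary using (Symmetric)
open import Relation.Binary.PropositionalEquality
  using (_≡_; _≢_; refl; sym; trans; cong; subst)
open import Relation.Binary.Construct.Closure.ReflexiveTransitive
  using (Star; ε; _◅_; _◅◅_; reverse)

-- Connected simple undirected graphs on the vertex set Fin n, unweighted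
-- (every edge has weight 1).
record Graph (n : ℕ) : Set₁ where
  field
    _~_       : Fin n → Fin n → Set
    ~-sym     : Symmetric _~_
    ~-irrefl  : ∀ {v} → ¬ (v ~ v)
    connected : ∀ u v → Star _~_ u v

  length : ∀ {u v} → Star _~_ u v → ℕ
  length ε       = 0
  length (_ ◅ p) = suc (length p)

  -- Distance u v k says d(u,v) = k.
  Distance : Fin n → Fin n → ℕ → Set
  Distance u v k =
    (∃[ p ] length {u} {v} p ≡ k) × (∀ (p : Star _~_ u v) → k ≤ length p)

  -- N v u x says x ∈ N(v,u), that is, d(v,x) = 1 + d(u,x).
  N : Fin n → Fin n → Fin n → Set
  N v u x = ∃[ k ] (Distance u x k × Distance v x (1 + k))

-- The unordered pair {u,u'} is represented by the subset ⁅ u ⁆ ∪ ⁅ u' ⁆,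
-- which is a singleton when u = u'.
data Response (n : ℕ) : Set where
  isTarget   : Response n
  directions : Subset n → Response n

module _ {n : ℕ} (G : Graph n) where
  open Graph G

  -- Answer t₁ t₂ v r: r is an admissible response to the query at v when the
  -- targets are t₁ and t₂.  As v ∉ N(v,u), a query at a target can only be
  -- answered by isTarget.
  data Answer (t₁ t₂ v : Fin n) : Response n → Set where
    isTarget   : v ≡ t₁ ⊎ v ≡ t₂ → Answer t₁ t₂ v isTarget
    directions : ∀ {u u'} → v ~ u → v ~ u' → N v u t₁ → N v u' t₂ →
                 Answer t₁ t₂ v (directions (⁅ u ⁆ ∪ ⁅ u' ⁆))

-- Deterministic adaptive algorithms as decision trees: either stop and
-- declare a vertex to be a target, or query a vertex and continue depending
-- on the response.
data Algorithm (n : ℕ) : Set where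
  output : Fin n → Algorithm n
  query  : Fin n → (Response n → Algorithm n) → Algorithm n

module _ {n : ℕ} (G : Graph n) (t₁ t₂ : Fin n) where

  -- Run A q x: for some choice of admissible responses, A makes exactly q
  -- queries and then outputs x.
  data Run : Algorithm n → ℕ → Fin n → Set where
    output : ∀ {x} → Run (output x) 0 x
    query  : ∀ {v A r q x} → Answer G t₁ t₂ v r → Run (A r) q x →
             Run (query v A) (suc q) x

DetectsTarget : ∀ {n} → Graph n → Algorithm n → Set
DetectsTarget G A = ∀ t₁ t₂ → t₁ ≢ t₂ →
  ∀ q x → Run G t₁ t₂ A q x → x ≡ t₁ ⊎ x ≡ t₂

Next : ∀ {n} → Fin n → Fin n → Set
Next {n} u v = suc (toℕ u) ≡ toℕ v ⊎ (suc (toℕ u) ≡ n × toℕ v ≡ 0)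

CycleAdj : ∀ {n} → Fin n → Fin n → Set
CycleAdj u v = Next u v ⊎ Next v u

cycle : (n : ℕ) → 3 ≤ n → Graph n
cycle n n≥3 = record
  { _~_       = CycleAdj
  ; ~-sym     = swap
  ; ~-irrefl  = λ { (inj₁ e) → irrefl e ; (inj₂ e) → irrefl e }
  ; connected = λ u v → toOrigin u ◅◅ reverse swap (toOrigin v)
  }
  where
  irrefl : ∀ {v : Fin n} → ¬ Next v v
  irrefl (inj₁ e) = contradiction e 1+n≢n
  irrefl (inj₂ (1+v≡n , v≡0))
    with s≤s () ← subst (3 ≤_) (trans (sym 1+v≡n) (cong suc v≡0)) n≥3

  origin : Fin n
  origin = fromℕ< (≤-trans (s≤s z≤n) n≥3)

  descend : ∀ m (m<n : m < n) → Star CycleAdj (fromℕ< m<n) origin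
  descend zero    m<n = ε
  descend (suc m) m<n = inj₂ (inj₁ step) ◅ descend m (<-trans (n<1+n m) m<n)
    where
    step : suc (toℕ (fromℕ< (<-trans (n<1+n m) m<n))) ≡ toℕ (fromℕ< m<n)
    step = trans (cong suc (toℕ-fromℕ< _)) (sym (toℕ-fromℕ< m<n))

  toOrigin : ∀ v → Star CycleAdj v origin
  toOrigin v =
    subst (λ u → Star CycleAdj u origin) (fromℕ<-toℕ v (toℕ<n v))
      (descend (toℕ v) (toℕ<n v))

{-# OPTIONS --safe #-}
module Submission where

-- The adversary only uses the n placements {i, i + m} with m = ⌊n/2⌋ and
-- indices modulo n.  Both arcs between such a pair have length at most m + 1,
-- so seen from any other vertex v the two targets are at distance at most m,
-- one in each direction: {next v, prev v} is a legal answer to a query at v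
-- (bothDirections-answers).  This answer depends on v alone, so as long as it
-- is given the algorithm learns nothing beyond the fact that the queried
-- vertices are not targets.
--
-- A vertex belongs to only two of the placements, namely those with i = v and
-- with i + m = v.  Hence, if a set of s vertices meets all the n placements,
-- then n ≤ 2s (avoided-or-small).  When the algorithm stops after q queries,
-- all answered by both directions, its q queried vertices together with its
-- output must meet every placement: a placement that avoids them all would
-- make the output wrong.  So n ≤ 2(q + 1).  If instead the queries alone meet
-- every placement, say from the q-th query on, then n ≤ 2q, and a placement
-- avoided by the first q - 1 queries forces the algorithm to make at least q
-- of them (worst-case).
--
-- Distances in the cycle are computed by lifting paths to the line ℕ along
-- the covering x ↦ x mod n (lift).

open import Defs
open import Data.Nat using (ℕ; zero; suc; _+_; _*_; _≤_; _<_; _∸_; ⌊_/2⌋; z≤n; s≤s)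
open import Data.Nat.Properties hiding (_≟_)
open import Data.Nat.DivMod
  using (_%_; _/_; _mod_; m≡m%n+[m/n]*n; m%n<n; m<n⇒m%n≡m; m%n%n≡m%n; n%n≡0;
         [m+n]%n≡m%n; %-distribˡ-+)
open import Data.Nat.Divisibility using (_∣_; n∣m*n; ∣m+n∣m⇒∣n; >⇒∤)
open import Data.Nat.Tactic.RingSolver using (solve-∀)
open import Data.Fin using (Fin; zero; toℕ)
open import Data.Fin.Properties using (toℕ-injective; toℕ-fromℕ<; toℕ<n; any?; injective⇒≤; _≟_)
open import Data.Fin.Subset using (⁅_⁆; _∪_)
open import Data.Fin.Subset.Properties using (∪-comm)
open import Data.List using (List; []; _∷_; _++_; map; length)
open import Data.List.Properties using (length-++; length-map)
open import Data.List.Relation.Unary.Any using (here; there)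
open import Data.List.Membership.Propositional using (_∈_; _∉_)
open import Data.List.Membership.Propositional.Properties using (∈-++⁺ˡ; ∈-++⁺ʳ; ∈-map⁺)
open import Data.List.Membership.Setoid.Properties using (index-injective)
import Data.List.Membership.DecPropositional as DecMembership
open import Data.Product using (∃-syntax; _×_; _,_)
open import Data.Sum using (_⊎_; inj₁; inj₂; [_,_]′; swap)
open import Function using (_∘_)
open import Relation.Nullary using (¬_; Dec; yes; no; ¬?; contradiction)
open import Relation.Nullary.Decidable using (_×-dec_; decidable-stable)
open import Relation.Binary using (tri<; tri≈; tri>)
open import Relation.Binary.PropositionalEquality
  using (_≡_; _≢_; refl; sym; trans; cong; subst; subst₂; setoid; module ≡-Reasoning)
open import Relation.Binary.Construct.Closure.ReflexiveTransitive using (Star; ε; _◅_)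

-- Natural numbers and finite lists

m<n⇒∃[o]1+o+m≡n : ∀ {m n} → m < n → ∃[ o ] suc o + m ≡ n
m<n⇒∃[o]1+o+m≡n {m} m<n with o , eq ← m≤n⇒∃[o]m+o≡n m<n =
  o , trans (cong suc (+-comm o m)) eq

covers⇒≤length : ∀ {n} (xs : List (Fin n)) → (∀ i → i ∈ xs) → n ≤ length xs
covers⇒≤length xs covers =
  injective⇒≤ (λ {i} {j} → index-injective (setoid _) (covers i) (covers j))

module _ (n′ : ℕ) (n≥3 : 3 ≤ suc n′) where

  private
    n : ℕ
    n = suc n′

    C : Graph n
    C = cycle n n≥3

    open Graph C using (Distance; N) renaming (length to pathLength)

  -- The covering of the cycle by the line

  -- The vertex below the point x of the line: x modulo n.
  vertex : ℕ → Fin n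
  vertex x = x mod n

  -- The two neighbours of v.  As n = n′ + 1, adding n′ is subtracting 1
  -- modulo n.
  next prev : Fin n → Fin n
  next v = vertex (suc (toℕ v))
  prev v = vertex (toℕ v + n′)

  toℕ-vertex : ∀ x → toℕ (vertex x) ≡ x % n
  toℕ-vertex x = toℕ-fromℕ< (m%n<n x n)

  vertex-cong : ∀ x y → x % n ≡ y % n → vertex x ≡ vertex y
  vertex-cong x y eq =
    toℕ-injective (trans (toℕ-vertex x) (trans eq (sym (toℕ-vertex y))))

  vertex-toℕ : ∀ v → vertex (toℕ v) ≡ v
  vertex-toℕ v = toℕ-injective (trans (toℕ-vertex (toℕ v)) (m<n⇒m%n≡m (toℕ<n v)))

  vertex-periodic : ∀ x → vertex (x + n) ≡ vertex x
  vertex-periodic x = vertex-cong (x + n) x ([m+n]%n≡m%n x n)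

  vertex-+ : ∀ x y → vertex (toℕ (vertex x) + y) ≡ vertex (x + y)
  vertex-+ x y = vertex-cong (toℕ (vertex x) + y) (x + y) (begin
    (toℕ (vertex x) + y) % n     ≡⟨ cong (λ z → (z + y) % n) (toℕ-vertex x) ⟩
    (x % n + y) % n              ≡⟨ %-distribˡ-+ (x % n) y n ⟩
    (x % n % n + y % n) % n      ≡⟨ cong (λ z → (z + y % n) % n) (m%n%n≡m%n x n) ⟩
    (x % n + y % n) % n          ≡⟨ %-distribˡ-+ x y n ⟨
    (x + y) % n                  ∎)
    where open ≡-Reasoning

  next-vertex : ∀ x → next (vertex x) ≡ vertex (suc x)
  next-vertex x = begin
    vertex (1 + toℕ (vertex x))   ≡⟨ cong vertex (+-comm 1 (toℕ (vertex x))) ⟩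
    vertex (toℕ (vertex x) + 1)   ≡⟨ vertex-+ x 1 ⟩
    vertex (x + 1)                ≡⟨ cong vertex (+-comm x 1) ⟩
    vertex (1 + x)                ∎
    where open ≡-Reasoning

  prev-vertex : ∀ x → prev (vertex (suc x)) ≡ vertex x
  prev-vertex x = begin
    vertex (toℕ (vertex (suc x)) + n′)   ≡⟨ vertex-+ (suc x) n′ ⟩
    vertex (suc x + n′)                  ≡⟨ cong vertex (+-suc x n′) ⟨
    vertex (x + n)                       ≡⟨ vertex-periodic x ⟩
    vertex x                             ∎
    where open ≡-Reasoning

  prev-next : ∀ v → prev (next v) ≡ v
  prev-next v = trans (prev-vertex (toℕ v)) (vertex-toℕ v)

  -- The covering is injective on every window of n consecutive integers.
  vertex-injective-window : ∀ {x y} → x < y → y < x + n → vertex x ≢ vertex y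
  vertex-injective-window {x} {y} x<y y<x+n eq
    with e , refl ← m<n⇒∃[o]1+o+m≡n x<y =
    >⇒∤ (+-cancelʳ-< x (suc e) n (subst (suc e + x <_) (+-comm x n) y<x+n))
      (∣m+n∣m⇒∣n (subst (n ∣_) multiples (n∣m*n (y / n))) (n∣m*n (x / n)))
    where
    open ≡-Reasoning
    shuffle : ∀ a b c → a + (b + c) ≡ b + (c + a)
    shuffle = solve-∀
    sameRemainder : x % n ≡ y % n
    sameRemainder = trans (sym (toℕ-vertex x)) (trans (cong toℕ eq) (toℕ-vertex y))
    multiples : y / n * n ≡ x / n * n + suc e
    multiples = +-cancelˡ-≡ (x % n) _ _ (begin
      x % n + y / n * n             ≡⟨ cong (_+ y / n * n) sameRemainder ⟩
      y % n + y / n * n             ≡⟨ m≡m%n+[m/n]*n y n ⟨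
      suc e + x                     ≡⟨ cong (suc e +_) (m≡m%n+[m/n]*n x n) ⟩
      suc e + (x % n + x / n * n)   ≡⟨ shuffle (suc e) (x % n) (x / n * n) ⟩
      x % n + (x / n * n + suc e)   ∎)

  -- Every vertex lies fewer than n steps ahead of any given vertex u.
  offset : ∀ u v → ∃[ k ] (k < n × v ≡ vertex (k + toℕ u))
  offset u v = toℕ (vertex d) , toℕ<n (vertex d) , (begin
    v                                ≡⟨ vertex-toℕ v ⟨
    vertex (toℕ v)                   ≡⟨ vertex-periodic (toℕ v) ⟨
    vertex (toℕ v + n)               ≡⟨ cong (λ z → vertex (toℕ v + z)) (m∸n+n≡m (<⇒≤ (toℕ<n u))) ⟨
    vertex (toℕ v + (n ∸ toℕ u + toℕ u)) ≡⟨ cong vertex (+-assoc (toℕ v) _ _) ⟨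
    vertex (d + toℕ u)               ≡⟨ vertex-+ d (toℕ u) ⟨
    vertex (toℕ (vertex d) + toℕ u)  ∎)
    where
    open ≡-Reasoning
    d : ℕ
    d = toℕ v + (n ∸ toℕ u)

  -- Adjacency and distances in the cycle

  Next-next : ∀ v → Next v (next v)
  Next-next v with m≤n⇒m<n∨m≡n (toℕ<n v)
  ... | inj₁ lt = inj₁ (sym (trans (toℕ-vertex (suc (toℕ v))) (m<n⇒m%n≡m lt)))
  ... | inj₂ eq = inj₂ (eq , trans (toℕ-vertex (suc (toℕ v))) (trans (cong (_% n) eq) (n%n≡0 n)))

  Next⇒≡next : ∀ {u v} → Next u v → v ≡ next u
  Next⇒≡next {u} {v} (inj₁ eq) = trans (sym (vertex-toℕ v)) (cong vertex (sym eq))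
  Next⇒≡next {u} {v} (inj₂ (u-last , v≡0)) = begin
    v                     ≡⟨ vertex-toℕ v ⟨
    vertex (toℕ v)        ≡⟨ cong vertex v≡0 ⟩
    vertex 0              ≡⟨ vertex-periodic 0 ⟨
    vertex n              ≡⟨ cong vertex u-last ⟨
    vertex (suc (toℕ u))  ∎
    where open ≡-Reasoning

  Adj⇒next∨prev : ∀ {u v} → CycleAdj u v → v ≡ next u ⊎ v ≡ prev u
  Adj⇒next∨prev (inj₁ u→v) = inj₁ (Next⇒≡next u→v)
  Adj⇒next∨prev {u} {v} (inj₂ v→u) =
    inj₂ (trans (sym (prev-next v)) (cong prev (sym (Next⇒≡next v→u))))

  adj-suc : ∀ x → CycleAdj (vertex x) (vertex (suc x))
  adj-suc x = inj₁ (subst (Next (vertex x)) (next-vertex x) (Next-next (vertex x)))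

  forwardPath : ∀ k x → ∃[ p ] pathLength {vertex x} {vertex (k + x)} p ≡ k
  forwardPath zero    x = ε , refl
  forwardPath (suc k) x
    with p , eq ← subst (λ z → ∃[ p ] pathLength {vertex (suc x)} {vertex z} p ≡ k)
                    (+-suc k x) (forwardPath k (suc x)) =
    adj-suc x ◅ p , cong suc eq

  backwardPath : ∀ k x → ∃[ p ] pathLength {vertex (k + x)} {vertex x} p ≡ k
  backwardPath zero    x = ε , refl
  backwardPath (suc k) x with p , eq ← backwardPath k x =
    swap (adj-suc (k + x)) ◅ p , cong suc eq

  -- A path lifts to the line from any lift x of its origin; the lift ends at
  -- some y with |x - y| at most the length of the path.  The hypothesis
  -- pathLength p ≤ x keeps the lift within ℕ.
  lift : ∀ {u v} (p : Star CycleAdj u v) x → u ≡ vertex x → pathLength p ≤ x →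
         ∃[ y ] (v ≡ vertex y × y ≤ x + pathLength p × x ≤ y + pathLength p)
  lift ε x u≡ _ = x , u≡ , m≤m+n x 0 , m≤m+n x 0
  lift {u} (_◅_ {j = w} u~w p) (suc x) u≡ (s≤s ℓ≤x) with Adj⇒next∨prev u~w
  ... | inj₁ w≡ with y , v≡ , y≤ , ≤y ← lift p (2 + x)
                       (trans w≡ (trans (cong next u≡) (next-vertex (suc x))))
                       (m≤n⇒m≤1+n (m≤n⇒m≤1+n ℓ≤x)) =
    y , v≡ ,
    subst (y ≤_) (cong suc (sym (+-suc x (pathLength p)))) y≤ ,
    ≤-trans (n≤1+n _) (≤-trans ≤y (+-monoʳ-≤ y (n≤1+n _)))
  ... | inj₂ w≡ with y , v≡ , y≤ , ≤y ← lift p x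
                       (trans w≡ (trans (cong prev u≡) (prev-vertex x))) ℓ≤x =
    y , v≡ ,
    ≤-trans y≤ (+-mono-≤ (n≤1+n x) (n≤1+n _)) ,
    subst (suc x ≤_) (sym (+-suc y (pathLength p))) (s≤s ≤y)

  -- Two vertices whose lifts are k apart, with k at most n/2, are at
  -- distance k: the lift of a shorter path, shifted by n to stay within ℕ,
  -- would end fewer than n away from the lift of its end.
  forwardDistance : ∀ k x → k + k ≤ n → Distance (vertex x) (vertex (k + x)) k
  forwardDistance k x 2k≤n = forwardPath k x , λ p → ≮⇒≥ (tooShort p)
    where
    open ≤-Reasoning
    shuffle : ∀ k y ℓ → k + (y + ℓ) ≡ y + (k + ℓ)
    shuffle = solve-∀
    k≤n : k ≤ n
    k≤n = ≤-trans (m≤m+n k k) 2k≤n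
    tooShort : ∀ p → ¬ pathLength p < k
    tooShort p ℓ<k
      with y , v≡ , y≤ , ≤y ← lift p (x + n) (sym (vertex-periodic x))
             (≤-trans (<⇒≤ ℓ<k) (≤-trans k≤n (m≤n+m n x))) =
      vertex-injective-window {y} {k + (x + n)}
        (begin-strict
          y                           ≤⟨ y≤ ⟩
          x + n + pathLength p        <⟨ +-monoʳ-< (x + n) ℓ<k ⟩
          x + n + k                   ≡⟨ +-comm (x + n) k ⟩
          k + (x + n)                 ∎)
        (begin-strict
          k + (x + n)                 ≤⟨ +-monoʳ-≤ k ≤y ⟩
          k + (y + pathLength p)      ≡⟨ shuffle k y (pathLength p) ⟩
          y + (k + pathLength p)      <⟨ +-monoʳ-< y (+-monoʳ-< k ℓ<k) ⟩
          y + (k + k)                 ≤⟨ +-monoʳ-≤ y 2k≤n ⟩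
          y + n                       ∎)
        (trans (sym v≡) (trans (sym (vertex-periodic (k + x)))
          (cong vertex (+-assoc k x n))))

  backwardDistance : ∀ k x → k + k ≤ n → Distance (vertex (k + x)) (vertex x) k
  backwardDistance k x 2k≤n = backwardPath k x , λ p → ≮⇒≥ (tooShort p)
    where
    open ≤-Reasoning
    shuffle : ∀ k x n ℓ → k + x + n + ℓ ≡ x + n + (k + ℓ)
    shuffle = solve-∀
    k≤n : k ≤ n
    k≤n = ≤-trans (m≤m+n k k) 2k≤n
    tooShort : ∀ p → ¬ pathLength p < k
    tooShort p ℓ<k
      with y , v≡ , y≤ , ≤y ← lift p (k + x + n) (sym (vertex-periodic (k + x)))
             (≤-trans (<⇒≤ ℓ<k) (≤-trans k≤n (m≤n+m n (k + x)))) =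
      vertex-injective-window {x + n} {y}
        (+-cancelʳ-< k (x + n) y (begin-strict
          x + n + k                   ≡⟨ +-comm (x + n) k ⟩
          k + (x + n)                 ≡⟨ +-assoc k x n ⟨
          k + x + n                   ≤⟨ ≤y ⟩
          y + pathLength p            <⟨ +-monoʳ-< y ℓ<k ⟩
          y + k                       ∎))
        (begin-strict
          y                           ≤⟨ y≤ ⟩
          k + x + n + pathLength p    ≡⟨ shuffle k x n (pathLength p) ⟩
          x + n + (k + pathLength p)  <⟨ +-monoʳ-< (x + n) (+-monoʳ-< k ℓ<k) ⟩
          x + n + (k + k)             ≤⟨ +-monoʳ-≤ (x + n) 2k≤n ⟩
          x + n + n                   ∎)
        (trans (vertex-periodic x) v≡)

  shorten : ∀ k → suc k + suc k ≤ n → k + k ≤ n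
  shorten k = ≤-trans (+-mono-≤ (n≤1+n k) (n≤1+n k))

  N-next : ∀ k x → suc k + suc k ≤ n →
           N (vertex x) (next (vertex x)) (vertex (suc k + x))
  N-next k x 2k≤n =
    k ,
    subst₂ (λ u z → Distance u (vertex z) k) (sym (next-vertex x)) (+-suc k x)
      (forwardDistance k (suc x) (shorten k 2k≤n)) ,
    forwardDistance (suc k) x 2k≤n

  N-prev : ∀ k x → suc k + suc k ≤ n →
           N (vertex (suc k + x)) (prev (vertex (suc k + x))) (vertex x)
  N-prev k x 2k≤n =
    k ,
    subst (λ u → Distance u (vertex x) k) (sym (prev-vertex (k + x)))
      (backwardDistance k x (shorten k 2k≤n)) ,
    backwardDistance (suc k) x 2k≤n

  -- The placements of the adversary

  private
    m : ℕ
    m = ⌊ n /2⌋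

    m+m≤n : m + m ≤ n
    m+m≤n = ≤-trans (+-monoʳ-≤ m (⌊n/2⌋≤⌈n/2⌉ n)) (≤-reflexive (⌊n/2⌋+⌈n/2⌉≡n n))

    n≤1+m+m : n ≤ suc (m + m)
    n≤1+m+m = ≤-trans (≤-reflexive (sym (⌊n/2⌋+⌈n/2⌉≡n n)))
      (≤-trans (+-monoʳ-≤ m (⌊n/2⌋-mono (n≤1+n (suc n)))) (≤-reflexive (+-suc m m)))

    double≤n : ∀ {k} → k ≤ m → k + k ≤ n
    double≤n k≤m = ≤-trans (+-mono-≤ k≤m k≤m) m+m≤n

    m<n : m < n
    m<n = ⌊n/2⌋<n n′

  -- The vertex m = ⌊n/2⌋ steps ahead.  The placements are the pairs
  -- {i, opposite i}; when n is even, each of them arises from two indices i.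
  opposite : Fin n → Fin n
  opposite i = vertex (m + toℕ i)

  i≢opposite : ∀ i → i ≢ opposite i
  i≢opposite i i≡ = vertex-injective-window
    (+-monoˡ-< (toℕ i) (⌊n/2⌋-mono {2} (≤-trans (n≤1+n 2) n≥3)))
    (subst (m + toℕ i <_) (+-comm n (toℕ i)) (+-monoˡ-< (toℕ i) m<n))
    (trans (vertex-toℕ i) i≡)

  -- The answer to a query at v saying that the targets lie on either side.
  bothDirections : Fin n → Response n
  bothDirections v = directions (⁅ next v ⁆ ∪ ⁅ prev v ⁆)

  v~next : ∀ v → CycleAdj v (next v)
  v~next v = inj₁ (Next-next v)

  v~prev : ∀ v → CycleAdj v (prev v)
  v~prev v = inj₂ (subst (Next (prev v)) next-prev (Next-next (prev v)))
    where
    open ≡-Reasoning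
    next-prev : next (prev v) ≡ v
    next-prev = begin
      next (vertex (toℕ v + n′))     ≡⟨ next-vertex (toℕ v + n′) ⟩
      vertex (suc (toℕ v + n′))      ≡⟨ cong vertex (+-suc (toℕ v) n′) ⟨
      vertex (toℕ v + n)             ≡⟨ vertex-periodic (toℕ v) ⟩
      vertex (toℕ v)                 ≡⟨ vertex-toℕ v ⟩
      v                              ∎

  next-prev-answer : ∀ {t₁ t₂ v} → N v (next v) t₁ → N v (prev v) t₂ →
                     Answer C t₁ t₂ v (bothDirections v)
  next-prev-answer = directions (v~next _) (v~prev _)

  prev-next-answer : ∀ {t₁ t₂ v} → N v (prev v) t₁ → N v (next v) t₂ →
                     Answer C t₁ t₂ v (bothDirections v)
  prev-next-answer {t₁} {t₂} {v} in₁ in₂ =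
    subst (λ s → Answer C t₁ t₂ v (directions s)) (∪-comm ⁅ prev v ⁆ ⁅ next v ⁆)
      (directions (v~prev _) (v~next _) in₁ in₂)

  -- With k the number of steps from i ahead to v, the vertex v is on the arc
  -- from i to its opposite when k < m, and on the other arc when m < k.
  bothDirections-answers : ∀ i v → v ≢ i → v ≢ opposite i →
                           Answer C i (opposite i) v (bothDirections v)
  bothDirections-answers i v v≢i v≢opp with offset i v
  ... | zero , _ , v≡ = contradiction (trans v≡ (vertex-toℕ i)) v≢i
  ... | k@(suc a) , k<n , refl with <-cmp k m
  ... | tri≈ _ k≡m _ = contradiction (cong (λ z → vertex (z + toℕ i)) k≡m) v≢opp
  ... | tri< k<m _ _ with b , b+k≡m ← m<n⇒∃[o]1+o+m≡n k<m =
    prev-next-answer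
      (subst (N v (prev v)) (vertex-toℕ i) (N-prev a (toℕ i) (double≤n (<⇒≤ k<m))))
      (subst (N v (next v)) opp≡
        (N-next b (k + toℕ i) (double≤n (≤-trans (m≤m+n (suc b) k) (≤-reflexive b+k≡m)))))
    where
    opp≡ : vertex (suc b + (k + toℕ i)) ≡ opposite i
    opp≡ = cong vertex (trans (sym (+-assoc (suc b) k (toℕ i))) (cong (_+ toℕ i) b+k≡m))
  ... | tri> _ _ m<k
      with c , c+m≡k ← m<n⇒∃[o]1+o+m≡n m<k
         | b , b+k≡n ← m<n⇒∃[o]1+o+m≡n k<n =
    next-prev-answer
      (subst (N v (next v)) i≡ (N-next b (k + toℕ i) (double≤n b<m)))
      (subst (λ w → N w (prev w) (opposite i)) v≡
        (N-prev c (m + toℕ i) (double≤n c<m)))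
    where
    open ≡-Reasoning
    i≡ : vertex (suc b + (k + toℕ i)) ≡ i
    i≡ = begin
      vertex (suc b + (k + toℕ i))  ≡⟨ cong vertex (+-assoc (suc b) k (toℕ i)) ⟨
      vertex (suc b + k + toℕ i)    ≡⟨ cong (λ z → vertex (z + toℕ i)) b+k≡n ⟩
      vertex (n + toℕ i)            ≡⟨ cong vertex (+-comm n (toℕ i)) ⟩
      vertex (toℕ i + n)            ≡⟨ vertex-periodic (toℕ i) ⟩
      vertex (toℕ i)                ≡⟨ vertex-toℕ i ⟩
      i                             ∎
    v≡ : vertex (suc c + (m + toℕ i)) ≡ v
    v≡ = cong vertex (trans (sym (+-assoc (suc c) m (toℕ i))) (cong (_+ toℕ i) c+m≡k))
    b+c≤m : suc b + c ≤ m
    b+c≤m = +-cancelʳ-≤ (suc m) (suc b + c) m (≤-trans (≤-reflexive (begin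
      suc b + c + suc m    ≡⟨ +-assoc (suc b) c (suc m) ⟩
      suc b + (c + suc m)  ≡⟨ cong (suc b +_) (trans (+-suc c m) c+m≡k) ⟩
      suc b + k            ≡⟨ b+k≡n ⟩
      n                    ∎)) (≤-trans n≤1+m+m (≤-reflexive (sym (+-suc m m)))))
    b<m : suc b ≤ m
    b<m = ≤-trans (m≤m+n (suc b) c) b+c≤m
    c<m : suc c ≤ m
    c<m = ≤-trans (s≤s (m≤n+m c b)) b+c≤m

  -- Counting placements

  -- The placement {i, opposite i} contains no vertex of S.
  Avoids : List (Fin n) → Fin n → Set
  Avoids S i = i ∉ S × opposite i ∉ S

  avoids? : ∀ S i → Dec (Avoids S i)
  avoids? S i = ¬? (i ∈? S) ×-dec ¬? (opposite i ∈? S)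
    where open DecMembership _≟_ using (_∈?_)

  -- The inverse of opposite.
  opposite⁻¹ : Fin n → Fin n
  opposite⁻¹ v = vertex (toℕ v + (n ∸ m))

  opposite⁻¹-opposite : ∀ i → opposite⁻¹ (opposite i) ≡ i
  opposite⁻¹-opposite i = begin
    vertex (toℕ (vertex (m + toℕ i)) + (n ∸ m))  ≡⟨ vertex-+ (m + toℕ i) (n ∸ m) ⟩
    vertex (m + toℕ i + (n ∸ m))                 ≡⟨ cong vertex (shuffle m (toℕ i) (n ∸ m)) ⟩
    vertex (toℕ i + (m + (n ∸ m)))               ≡⟨ cong (λ z → vertex (toℕ i + z)) (m+[n∸m]≡n (<⇒≤ m<n)) ⟩
    vertex (toℕ i + n)                           ≡⟨ vertex-periodic (toℕ i) ⟩
    vertex (toℕ i)                               ≡⟨ vertex-toℕ i ⟩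
    i                                            ∎
    where
    open ≡-Reasoning
    shuffle : ∀ a b c → a + b + c ≡ b + (a + c)
    shuffle = solve-∀

  -- If S meets every placement, then S and its image under opposite⁻¹
  -- together contain every index i.
  avoided-or-small : ∀ S → (∃[ i ] Avoids S i) ⊎ n ≤ 2 * length S
  avoided-or-small S with any? (avoids? S)
  ... | yes avoided = inj₁ avoided
  ... | no  none    = inj₂ (subst (n ≤_) length≡ (covers⇒≤length (S ++ S⁻¹) covers))
    where
    open DecMembership (_≟_ {n}) using (_∈?_)
    S⁻¹ : List (Fin n)
    S⁻¹ = map opposite⁻¹ S
    covers : ∀ i → i ∈ S ++ S⁻¹
    covers i = decidable-stable (i ∈? (S ++ S⁻¹)) λ i∉ → none (i ,
      i∉ ∘ ∈-++⁺ˡ ,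
      λ opp∈S → i∉ (∈-++⁺ʳ S
        (subst (_∈ S⁻¹) (opposite⁻¹-opposite i) (∈-map⁺ opposite⁻¹ opp∈S))))
    length≡ : length (S ++ S⁻¹) ≡ 2 * length S
    length≡ = begin
      length (S ++ S⁻¹)       ≡⟨ length-++ S ⟩
      length S + length S⁻¹   ≡⟨ cong (length S +_) (length-map opposite⁻¹ S) ⟩
      length S + length S     ≡⟨ cong (length S +_) (+-identityʳ (length S)) ⟨
      2 * length S            ∎
      where open ≡-Reasoning

  -- The adversary

  -- On every placement, every algorithm has a complete run.
  run : ∀ i A → ∃[ q ] ∃[ x ] Run C i (opposite i) A q x
  run i (output x) = 0 , x , output
  run i (query v A) with v ≟ i | v ≟ opposite i
  ... | yes v≡i | _ with q , x , R ← run i (A isTarget) =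
    suc q , x , query (isTarget (inj₁ v≡i)) R
  ... | no _ | yes v≡opp with q , x , R ← run i (A isTarget) =
    suc q , x , query (isTarget (inj₂ v≡opp)) R
  ... | no v≢i | no v≢opp with q , x , R ← run i (A (bothDirections v)) =
    suc q , x , query (bothDirections-answers i v v≢i v≢opp) R

  weaken : ∀ {S v i} → Avoids (v ∷ S) i → Avoids S i
  weaken (i∉ , opp∉) = i∉ ∘ there , opp∉ ∘ there

  answer-avoided : ∀ {S v i} → Avoids (v ∷ S) i →
                   Answer C i (opposite i) v (bothDirections v)
  answer-avoided (i∉ , opp∉) =
    bothDirections-answers _ _ (i∉ ∘ here ∘ sym) (opp∉ ∘ here ∘ sym)

  -- S is the list of vertices queried so far, all answered by both
  -- directions, and A is the rest of the algorithm, which is correct on the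
  -- placements still possible.
  worst-case : ∀ S A →
    (∀ i → Avoids S i → ∀ q x → Run C i (opposite i) A q x → x ≡ i ⊎ x ≡ opposite i) →
    ∃[ i ] Avoids S i →
    ∃[ i ] ∃[ q ] ∃[ x ]
      (Avoids S i × Run C i (opposite i) A q x × n ≤ 2 * (length S + suc q))
  worst-case S (output x) correct (i , avoids) with avoided-or-small (x ∷ S)
  ... | inj₁ (j , j∉ , opp∉) = contradiction
    (correct j (j∉ ∘ there , opp∉ ∘ there) 0 x output)
    [ j∉ ∘ here ∘ sym , opp∉ ∘ here ∘ sym ]′
  ... | inj₂ n≤ =
    i , 0 , x , avoids , output , subst (λ z → n ≤ 2 * z) (+-comm 1 (length S)) n≤
  worst-case S (query v A) correct (i , avoids) with avoided-or-small (v ∷ S)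
  ... | inj₁ avoided
      with j , q , x , av , R , n≤ ←
             worst-case (v ∷ S) (A (bothDirections v))
               (λ j av q x R → correct j (weaken av) (suc q) x (query (answer-avoided av) R))
               avoided =
    j , suc q , x , weaken av , query (answer-avoided av) R ,
    subst (λ z → n ≤ 2 * z) (sym (+-suc (length S) (suc q))) n≤
  -- The queries up to v already meet every placement.
  ... | inj₂ n≤ with q , x , R ← run i (query v A) =
    i , q , x , avoids , R , ≤-trans n≤ (*-monoʳ-≤ 2
      (≤-trans (≤-reflexive (+-comm 1 (length S))) (+-monoʳ-≤ (length S) (s≤s z≤n))))

theorem10 : (n : ℕ) (n≥3 : 3 ≤ n) (A : Algorithm n) →
    DetectsTarget (cycle n n≥3) A →
    ∃[ t₁ ] ∃[ t₂ ] ∃[ q ] ∃[ x ]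
    (t₁ ≢ t₂ × Run (cycle n n≥3) t₁ t₂ A q x × n ≤ 2 * (q + 1))
theorem10 (suc n′) n≥3 A detects
  with i , q , x , _ , R , n≤ ←
         worst-case n′ n≥3 [] A
           (λ i _ q x R → detects i (opposite n′ n≥3 i) (i≢opposite n′ n≥3 i) q x R)
           (zero , (λ ()) , (λ ())) =
  i , opposite n′ n≥3 i , q , x , i≢opposite n′ n≥3 i , R ,
  subst (λ z → suc n′ ≤ 2 * z) (+-comm 1 q) n≤
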